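{- For every length $n$ and every integer $\delta\in[2\mathinner{.\,.} n]$ there exists a string $S[1\mathinner{.\,.} n]$ with $\delta(S)=\delta$ whose smallest context-free grammar has size $g(S)=\Omega\!\left(\delta\log^2\frac{n}{\delta}/\log\log\frac{n}{\delta}\right)$ (with a universal constant in the $\Omega$).
   Context: For a string $S$ of length $n$ and $k\in[1\mathinner{.\,.} n]$, $d_k(S)$ is the number of distinct length-$k$ substrings of $S$ and $\delta(S)=\max\{d_k(S)/k : k\in[1\mathinner{.\,.} n]\}$. $g(S)$ is the minimum size of a context-free grammar generating exactly the single string $S$, where the size of a grammar is the total length of the right-hand sides of its rules. The alphabet may be chosen freely. -}

module Defs where

open import Data.Nat using (ℕ; zero; suc; _+_; _*_; _∸_; _≤_; _/_; _^_)
open import Data.Nat.Properties using (_≟_)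
open import Data.Nat.Logarithm using (⌊log₂_⌋)
open import Data.Fin using (Fin)
open import Data.List using (List; []; _∷_; length; take; drop; map; upTo; deduplicate; _++_)
open import Data.Nat.ListAction using (sum)
open import Data.List.Properties using (≡-dec)
open import Data.List.Membership.Propositional using (_∈_)
open import Data.Product using (Σ; _×_; _,_)
open import Data.Sum using (_⊎_; inj₁; inj₂)
open import Relation.Binary.PropositionalEquality using (_≡_)

-- Strings: lists over the alphabet ℕ (the alphabet may be chosen freely;
-- any finite alphabet embeds into ℕ).
Str : Set
Str = List ℕ

-- All length-k substrings S[i+1 .. i+k], i ∈ [0 .. n-k]  (for 1 ≤ k ≤ n).
substringsOfLength : ℕ → Str → List Str
substringsOfLength k S = map (λ i → take k (drop i S)) (upTo (suc (length S ∸ k)))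

d : ℕ → Str → ℕ
d k S = length (deduplicate (≡-dec _≟_) (substringsOfLength k S))

-- δ(S) = δ, i.e. max { d_k(S)/k : k ∈ [1..n] } = δ, written out:
-- every ratio d_k(S)/k is ≤ δ, and some ratio equals δ.
HasDelta : Str → ℕ → Set
HasDelta S δ =
  ((k : ℕ) → 1 ≤ k → k ≤ length S → d k S ≤ δ * k) ×
  Σ ℕ (λ k → 1 ≤ k × k ≤ length S × d k S ≡ δ * k)

Symbol : ℕ → Set
Symbol N = Fin N ⊎ ℕ

record CFG (N : ℕ) : Set where
  field
    start : Fin N
    rules : List (Fin N × List (Symbol N))

open CFG public

size : ∀ {N} → CFG N → ℕ
size G = sum (map (λ r → length (Data.Product.proj₂ r)) (rules G))

mutual
  data DerivesSym {N} (G : CFG N) : Symbol N → Str → Set where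
    term : ∀ a → DerivesSym G (inj₂ a) (a ∷ [])
    rule : ∀ {A rhs w} → (A , rhs) ∈ rules G → DerivesSeq G rhs w →
           DerivesSym G (inj₁ A) w

  data DerivesSeq {N} (G : CFG N) : List (Symbol N) → Str → Set where
    []  : DerivesSeq G [] []
    _∷_ : ∀ {X Xs u v} → DerivesSym G X u → DerivesSeq G Xs v →
          DerivesSeq G (X ∷ Xs) (u ++ v)

GeneratesExactly : ∀ {N} → CFG N → Str → Set
GeneratesExactly G S =
  ((w : Str) → DerivesSym G (inj₁ (start G)) w → w ≡ S) ×
  DerivesSym G (inj₁ (start G)) S

-- floor division with n ÷ 0 = 0 (only used with δ ≥ 2)
_÷_ : ℕ → ℕ → ℕ
n ÷ zero = 0
n ÷ suc m = n / suc m

-- Lower-bound expression δ·log²(n/δ) (numerator) and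
-- loglog(n/δ) (denominator, clamped to be ≥ 1) using floor logs base 2.
boundNum : ℕ → ℕ → ℕ
boundNum n δ = δ * ⌊log₂ (n ÷ δ) ⌋ ^ 2

boundDen : ℕ → ℕ → ℕ
boundDen n δ = suc ⌊log₂ ⌊log₂ (n ÷ δ) ⌋ ⌋

{-# OPTIONS --safe #-}
module Submission where

-- Expand a straight-line part of the grammar in topological order, spelling out
-- only the first occurrence of each nonterminal and letting every later one point
-- to the range of phrases that the first has become.  The result is a word the
-- grammar generates, hence S, cut into at most g phrases, each a letter or a copy
-- of a range of earlier phrases.  K phrases are described by O(K log K) bits,
-- whereas there are 2^(L²) binary words of length at most 4^L whose 1s are
-- separated by geometrically growing gaps; so one of them, w, needs Ω(L²/log L)
-- phrases.
--
-- S consists of Θ(δ) copies of w over disjoint alphabets, preceded by single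
-- letters so that exactly δ letters occur, with 4^L ≤ n/δ.  A copied phrase cannot
-- straddle two alphabets, as a letter of the second would then precede one of the
-- first; so the phrase counts of the copies of w add up.  The gaps are sparse
-- enough for each copy of w to have at most 2k substrings of length k; with at
-- most k - 1 more across each boundary, d_k(S) ≤ δk for all k, with equality at
-- k = 1.

open import Defs
open import Data.Bool using (Bool; true; false; if_then_else_; not)
import Data.Bool.Properties as Bool
open import Data.Fin using (Fin)
import Data.Fin.Properties as Fin
open import Data.List hiding (sum; product; find; fromMaybe; lookup)
open import Data.List.Membership.DecPropositional using (_∈?_)
open import Data.List.Membership.Propositional using (_∈_; _∉_; find)
open import Data.List.Membership.Propositional.Properties
open import Data.List.Properties hiding (sum-++)
open import Data.List.Relation.Binary.Subset.Propositional using (_⊆_)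
open import Data.List.Relation.Unary.All as All using (All; []; _∷_)
import Data.List.Relation.Unary.All.Properties as All
open import Data.List.Relation.Unary.AllPairs using (AllPairs; []; _∷_)
import Data.List.Relation.Unary.AllPairs.Properties as AllPairs
open import Data.List.Relation.Unary.Any using (here; there)
open import Data.List.Relation.Unary.Unique.DecPropositional.Properties using (deduplicate-!)
open import Data.List.Relation.Unary.Unique.Propositional using (Unique)
import Data.List.Relation.Unary.Unique.Propositional.Properties as Unique
open import Data.Maybe using (Maybe; just; nothing)
open import Data.Nat
open import Data.Nat.DivMod using (m≡m%n+[m/n]*n; m%n<n; m/n*n≤m; m/n≤m; m≥n⇒m/n>0)
open import Data.Nat.ListAction using (sum)
open import Data.Nat.ListAction.Properties using (sum-++)
open import Data.Nat.Logarithm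
open import Data.Nat.Properties hiding (_≟_)
open import Data.Nat.Tactic.RingSolver using (solve-∀)
open import Data.Product using (Σ; ∃-syntax; _×_; _,_; proj₁; proj₂)
open import Data.Sum using (_⊎_; inj₁; inj₂; isInj₂)
open import Data.Unit using (⊤; tt)
open import Function using (_∘_)
open import Relation.Binary.Definitions using (DecidableEquality)
open import Relation.Binary.PropositionalEquality
  using (_≡_; refl; sym; trans; cong; cong₂; subst; subst₂; module ≡-Reasoning)
open import Relation.Nullary using (yes; no; contradiction; does)
open import Relation.Nullary.Decidable using (dec-true; dec-false)

-- Phrase parses and their projections

private variable
  A B C : Set
  P Q W W′ : List (List A)
  w s s′ : List A
  k : ℕ

data Copyable {A : Set} (Q : List (List A)) : List A → Set where
  range : ∀ xs ys zs → Q ≡ xs ++ ys ++ zs → Copyable Q (concat ys)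

-- A phrase may only refer to whole earlier phrases; with pointers into the text
-- itself a phrase would cost log n rather than log (number of phrases) bits.
data Parse {A : Set} : List (List A) → Set where
  []   : Parse []
  char : Parse Q → ∀ x → Parse (Q ∷ʳ [ x ])
  copy : Parse Q → Copyable Q w → Parse (Q ∷ʳ w)

NeedsPhrases : ℕ → List A → Set
NeedsPhrases K s = ∀ {P} → Parse P → concat P ≡ s → K ≤ length P

concat-∷ʳ : ∀ (P : List (List A)) w → concat (P ∷ʳ w) ≡ concat P ++ w
concat-∷ʳ P w = trans (sym (concat-++ P [ w ])) (cong (concat P ++_) (++-identityʳ w))

length-∷ʳ : ∀ (P : List A) x → length (P ∷ʳ x) ≡ suc (length P)
length-∷ʳ P x = trans (length-++ P) (+-comm (length P) 1)

parse-++-chars : Parse P → ∀ s → Parse (P ++ map [_] s)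
parse-++-chars {P = P} p []      = subst Parse (sym (++-identityʳ P)) p
parse-++-chars {P = P} p (x ∷ s) =
  subst Parse (++-assoc P _ _) (parse-++-chars (char p x) s)

-- A phrase erased by a projection has to disappear instead of staying as an empty phrase: only then
-- can the counts of two complementary projections add up to at most the original count.
unlessEmpty : List A → List (List A)
unlessEmpty []       = []
unlessEmpty (x ∷ xs) = [ x ∷ xs ]

project : (A → Maybe B) → List (List A) → List (List B)
project h = concatMap (unlessEmpty ∘ mapMaybe h)

concat-unlessEmpty : (s : List A) (P : List (List A)) → concat (unlessEmpty s ++ P) ≡ s ++ concat P
concat-unlessEmpty []      P = refl
concat-unlessEmpty (x ∷ s) P = refl

concat-project : ∀ (h : A → Maybe B) P → concat (project h P) ≡ mapMaybe h (concat P)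
concat-project h []      = refl
concat-project h (p ∷ P) = begin
  concat (unlessEmpty (mapMaybe h p) ++ project h P) ≡⟨ concat-unlessEmpty (mapMaybe h p) _ ⟩
  mapMaybe h p ++ concat (project h P)               ≡⟨ cong (mapMaybe h p ++_) (concat-project h P) ⟩
  mapMaybe h p ++ mapMaybe h (concat P)              ≡⟨ mapMaybe-++ h p (concat P) ⟨
  mapMaybe h (p ++ concat P)                         ∎
  where open ≡-Reasoning

-- `project h` respects concatenation of phrase lists, so a range of phrases goes to a range of
-- phrases.
copyable-project : ∀ (h : A → Maybe B) → Copyable Q w → Copyable (project h Q) (mapMaybe h w)
copyable-project h (range xs ys zs refl) =
  subst (Copyable _) (concat-project h ys)
    (range (project h xs) (project h ys) (project h zs)
      (trans (concatMap-++ _ xs (ys ++ zs)) (cong (project h xs ++_) (concatMap-++ _ ys zs))))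

parse-++-unlessEmpty : ∀ w → Parse Q → Parse (Q ∷ʳ w) → Parse (Q ++ unlessEmpty w)
parse-++-unlessEmpty {Q = Q} []      p _ = subst Parse (sym (++-identityʳ Q)) p
parse-++-unlessEmpty         (x ∷ w) _ p = p

project-∷ʳ : ∀ (h : A → Maybe B) Q w → project h (Q ∷ʳ w) ≡ project h Q ++ unlessEmpty (mapMaybe h w)
project-∷ʳ h Q w = trans (concatMap-++ _ Q [ w ]) (cong (project h Q ++_) (++-identityʳ _))

parse-project : ∀ (h : A → Maybe B) → Parse P → Parse (project h P)
parse-project h [] = []
parse-project h (char {Q = Q} p x) = subst Parse (sym (project-∷ʳ h Q [ x ])) step
  where
  step : Parse (project h Q ++ unlessEmpty (mapMaybe h [ x ]))
  step with h x
  ... | just y  = char (parse-project h p) y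
  ... | nothing = subst Parse (sym (++-identityʳ _)) (parse-project h p)
parse-project h (copy {Q = Q} {w = w} p c) =
  subst Parse (sym (project-∷ʳ h Q w))
    (parse-++-unlessEmpty _ (parse-project h p) (copy (parse-project h p) (copyable-project h c)))

length-unlessEmpty : (s : List A) → length (unlessEmpty s) ≤ 1
length-unlessEmpty []      = z≤n
length-unlessEmpty (x ∷ s) = ≤-refl

length-project : ∀ (h : A → Maybe B) P → length (project h P) ≤ length P
length-project h []      = z≤n
length-project h (p ∷ P) = ≤-trans (≤-reflexive (length-++ (unlessEmpty (mapMaybe h p))))
  (+-mono-≤ (length-unlessEmpty (mapMaybe h p)) (length-project h P))

-- Any parse of the renamed word projects back along the partial inverse `g`, and projecting never
-- adds phrases.
needsPhrases-map : ∀ {K} {s : List A} (f : A → B) (g : B → Maybe A) → (∀ x → g (f x) ≡ just x) →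
                   NeedsPhrases K s → NeedsPhrases K (map f s)
needsPhrases-map {s = s} f g g∘f lb {P} p eq =
  ≤-trans (lb (parse-project g p) (trans (concat-project g P)
    (trans (cong (mapMaybe g) eq) (mapMaybe-map-retract g∘f s))))
    (length-project g P)

-- Words over two separated alphabets

module _ (χ : A → Bool) where

  Uniform : Bool → List A → Set
  Uniform b = All (λ x → χ x ≡ b)

  Increasing : List A → Set
  Increasing = AllPairs (λ x y → χ x ≡ true → χ y ≡ true)

  increasing-++⁻ : ∀ s {t} → Increasing (s ++ t) →
                   Increasing s × (∀ {x y} → x ∈ s → y ∈ t → χ x ≡ true → χ y ≡ true)
  increasing-++⁻ []      _        = [] , λ ()
  increasing-++⁻ (x ∷ s) (r ∷ rs) with increasing-++⁻ s rs
  ... | inc , cross = All.++⁻ˡ s r ∷ inc , λ where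
    (here refl) y∈t → All.lookup (All.++⁻ʳ s r) y∈t
    (there x∈s) y∈t → cross x∈s y∈t

  false≢true : ∀ {b} → b ≡ false → b ≡ true → {C : Set} → C
  false≢true refl ()

  -- The hypothesis covers pairs in either order, so a single letter marked true marks all of them.
  uniform-or : ∀ w → (∀ {x y} → x ∈ w → y ∈ w → χ x ≡ true → χ y ≡ true) →
               Uniform true w ⊎ Uniform false w
  uniform-or []      _ = inj₁ []
  uniform-or (x ∷ w) f with χ x in eq
  ... | true  = inj₁ (eq ∷ All.tabulate λ y∈w → f (here refl) (there y∈w) eq)
  ... | false = inj₂ (eq ∷ All.tabulate λ y∈w → isFalse y∈w)
    where
    isFalse : ∀ {y} → y ∈ w → χ y ≡ false
    isFalse {y} y∈w with χ y in eq′
    ... | false = refl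
    ... | true  = false≢true eq (f (there y∈w) (here refl) eq′)

  copy-⊆ : Copyable Q w → ∀ {x} → x ∈ w → x ∈ concat Q
  copy-⊆ (range xs ys zs refl) x∈ =
    subst (_ ∈_) (trans (cong (concat xs ++_) (concat-++ ys zs)) (concat-++ xs (ys ++ zs)))
      (∈-++⁺ʳ (concat xs) (∈-++⁺ˡ x∈))

  -- A copied phrase occurs both earlier and now, so any two of its letters
  -- occur in S in either order.
  phrases-uniform : Parse P → Increasing (concat P) →
                    All (λ p → Uniform true p ⊎ Uniform false p) P
  phrases-uniform [] _ = []
  phrases-uniform (char {Q = Q} p x) inc =
    All.∷ʳ⁺ (phrases-uniform p (proj₁ (increasing-++⁻ (concat Q) (subst Increasing (concat-∷ʳ Q _) inc))))
            (uniform-or [ x ] λ where (here refl) (here refl) eq → eq)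
  phrases-uniform (copy {Q = Q} {w = w} p c) inc =
    let incQ , cross = increasing-++⁻ (concat Q) (subst Increasing (concat-∷ʳ Q w) inc)
    in All.∷ʳ⁺ (phrases-uniform p incQ) (uniform-or w λ x∈w y∈w → cross (copy-⊆ c x∈w) y∈w)

  keep : Bool → A → Maybe A
  keep true  x = if χ x then just x else nothing
  keep false x = if χ x then nothing else just x

  keep-same : ∀ b s → Uniform b s → mapMaybe (keep b) s ≡ s
  keep-same b     []      []         = refl
  keep-same true  (x ∷ s) (eq ∷ eqs) rewrite eq = cong (x ∷_) (keep-same true s eqs)
  keep-same false (x ∷ s) (eq ∷ eqs) rewrite eq = cong (x ∷_) (keep-same false s eqs)

  keep-other : ∀ b s → Uniform (not b) s → mapMaybe (keep b) s ≡ []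
  keep-other b     []      []         = refl
  keep-other true  (x ∷ s) (eq ∷ eqs) rewrite eq = keep-other true s eqs
  keep-other false (x ∷ s) (eq ∷ eqs) rewrite eq = keep-other false s eqs

  -- A uniform phrase is erased by the projection to the other class, so it counts in only one of
  -- the two lengths.
  length-split : ∀ P → All (λ p → Uniform true p ⊎ Uniform false p) P →
                 length (project (keep false) P) + length (project (keep true) P) ≤ length P
  length-split []      []       = z≤n
  length-split (p ∷ P) (u ∷ us)
    rewrite length-++ (unlessEmpty (mapMaybe (keep false) p)) {project (keep false) P}
          | length-++ (unlessEmpty (mapMaybe (keep true) p)) {project (keep true) P}
    with u
  ... | inj₁ allTrue rewrite keep-other false p allTrue = begin
    f + (length (unlessEmpty (mapMaybe (keep true) p)) + t)
                  ≤⟨ +-monoʳ-≤ f (+-monoˡ-≤ t (length-unlessEmpty (mapMaybe (keep true) p))) ⟩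
    f + (1 + t)   ≡⟨ +-assoc f 1 t ⟨
    f + 1 + t     ≡⟨ cong (_+ t) (+-comm f 1) ⟩
    suc (f + t)   ≤⟨ s≤s (length-split P us) ⟩
    suc (length P) ∎
    where
    open ≤-Reasoning
    f = length (project (keep false) P)
    t = length (project (keep true) P)
  ... | inj₂ allFalse rewrite keep-other true p allFalse =
    ≤-trans (+-monoˡ-≤ t (+-monoˡ-≤ f (length-unlessEmpty (mapMaybe (keep false) p))))
            (s≤s (length-split P us))
    where
    f = length (project (keep false) P)
    t = length (project (keep true) P)

  -- One parse of `s ++ t` projects both to a parse of `s` and to a parse of `t`. As no phrase
  -- straddles the two classes, these two share its phrases between them.
  needsPhrases-++ : ∀ {K L s t} → Uniform false s → Uniform true t →
                    NeedsPhrases K s → NeedsPhrases L t → NeedsPhrases (K + L) (s ++ t)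
  needsPhrases-++ {K} {L} {s} {t} us ut lbs lbt {P} p eq =
    ≤-trans (+-mono-≤ (lbs (parse-project (keep false) p) eqs) (lbt (parse-project (keep true) p) eqt))
            (length-split P (phrases-uniform p (subst Increasing (sym eq) inc)))
    where
    inc : Increasing (s ++ t)
    inc = AllPairs.++⁺ (falses-increasing s us) (trues-increasing t ut)
            (All.map (λ e → All.map (λ e′ _ → e′) ut) us)
      where
      falses-increasing : ∀ s → Uniform false s → Increasing s
      falses-increasing []      []       = []
      falses-increasing (x ∷ s) (e ∷ es) = All.tabulate (λ _ e′ → false≢true e e′) ∷ falses-increasing s es
      trues-increasing : ∀ s → Uniform true s → Increasing s
      trues-increasing []      []       = []
      trues-increasing (x ∷ s) (e ∷ es) = All.map (λ e′ _ → e′) es ∷ trues-increasing s es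

    restrict : ∀ b → mapMaybe (keep b) (concat P) ≡ mapMaybe (keep b) s ++ mapMaybe (keep b) t
    restrict b = trans (cong (mapMaybe (keep b)) eq) (mapMaybe-++ (keep b) s t)

    eqs : concat (project (keep false) P) ≡ s
    eqs = trans (concat-project (keep false) P) (trans (restrict false)
      (trans (cong₂ _++_ (keep-same false s us) (keep-other false t ut)) (++-identityʳ s)))

    eqt : concat (project (keep true) P) ≡ t
    eqt = trans (concat-project (keep true) P) (trans (restrict true)
      (cong₂ _++_ (keep-other true s us) (keep-same true t ut)))

-- From grammars to phrases

copyable-∷ʳ : ∀ {A : Set} {Q : List (List A)} {w} v → Copyable Q w → Copyable (Q ++ v) w
copyable-∷ʳ v (range xs ys zs refl) =
  range xs ys (zs ++ v) (trans (++-assoc xs (ys ++ zs) v) (cong (xs ++_) (++-assoc ys zs v)))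

map-++⁻ : ∀ (f : A → B) zs xs {ys} → map f zs ≡ xs ++ ys →
          ∃[ us ] ∃[ vs ] zs ≡ us ++ vs × map f us ≡ xs × map f vs ≡ ys
map-++⁻ f zs       []       eq   = [] , zs , refl , refl , eq
map-++⁻ f (z ∷ zs) (x ∷ xs) eq with ∷-injective eq
... | refl , eq′ = let us , vs , eq″ , eqᵤ , eqᵥ = map-++⁻ f zs xs eq′
                   in z ∷ us , vs , cong (z ∷_) eq″ , cong (f z ∷_) eqᵤ , eqᵥ

-- `σ` models the application of one grammar rule. All replaced letters become the same word, so a
-- single spelled-out `rhs` serves them all.
module _ {A : Set} (σ : A → List A) (rhs : List A) (σ-cases : ∀ x → σ x ≡ [ x ] ⊎ σ x ≡ rhs) where

  private
    σ* : List A → List A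
    σ* = concatMap σ

    concat-σ* : ∀ ys → concat (map σ* ys) ≡ σ* (concat ys)
    concat-σ* []       = refl
    concat-σ* (y ∷ ys) = trans (cong (σ* y ++_) (concat-σ* ys)) (sym (concatMap-++ σ y (concat ys)))

  -- Left: no extra phrases have been spent so far. Right: `rhs` has been paid for once and is a
  -- range that later phrases can copy.
  Cost : List (List A) → List (List A) → Set
  Cost P P′ = length P′ ≤ length P ⊎ Copyable P′ rhs × length P′ ≤ length P + length rhs

  -- One phrase may turn into several, so the new phrases are kept in groups, one group per old
  -- phrase. This is what lets a range of old phrases translate into a range of new ones.
  record Substituted (P : List (List A)) : Set where
    constructor substituted
    field
      groups   : List (List (List A))
      images   : map concat groups ≡ map σ* P
      isParse  : Parse (concat groups)
      cost     : Cost P (concat groups)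

  open Substituted

  private
    extend : ∀ {P} w (S : Substituted P) g → concat g ≡ σ* w → Parse (concat (groups S) ++ g) →
             length g ≤ 1 → Substituted (P ∷ʳ w)
    extend {P} w S g eq parse len = record
      { groups  = groups S ∷ʳ g
      ; images  = trans (map-++ concat (groups S) [ g ])
                    (trans (cong₂ _++_ (images S) (cong [_] eq)) (sym (map-++ σ* P [ w ])))
      ; isParse = subst Parse (sym (concat-∷ʳ (groups S) g)) parse
      ; cost    = newCost (cost S)
      }
      where
      lengthen : ∀ {k} → length (concat (groups S)) ≤ k → length (concat (groups S ∷ʳ g)) ≤ suc k
      lengthen {k} le rewrite concat-∷ʳ (groups S) g | length-++ (concat (groups S)) {g} =
        ≤-trans (+-mono-≤ le len) (≤-reflexive (+-comm k 1))
      newCost : Cost P (concat (groups S)) → Cost (P ∷ʳ w) (concat (groups S ∷ʳ g))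
      newCost (inj₁ le)       rewrite length-∷ʳ P w = inj₁ (lengthen le)
      newCost (inj₂ (c , le)) rewrite length-∷ʳ P w =
        inj₂ (subst (λ G → Copyable G rhs) (sym (concat-∷ʳ (groups S) g)) (copyable-∷ʳ g c) , lengthen le)

  -- Only the first literal occurrence of the replaced letter is spelled out as
  -- rhs; later ones become copies of it, and ranges of phrases map to ranges.
  parse-subst : Parse P → Substituted P
  parse-subst [] = substituted [] refl [] (inj₁ z≤n)
  parse-subst (char {Q = P} p x) with parse-subst p | σ-cases x
  ... | S | inj₁ eq = extend [ x ] S [ [ x ] ] (sym (trans (++-identityʳ (σ x)) eq)) (char (isParse S) x) ≤-refl
  ... | S@(substituted _ _ _ (inj₂ (c , _))) | inj₂ eq =
    extend [ x ] S [ rhs ] (cong (_++ []) (sym eq)) (copy (isParse S) c) ≤-refl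
  ... | S@(substituted gs eqs p′ (inj₁ le)) | inj₂ eq = record
    { groups  = gs ∷ʳ map [_] rhs
    ; images  = trans (map-++ concat gs [ map [_] rhs ]) (trans (cong₂ _++_ eqs
                  (cong [_] (trans concat-map-[ rhs ] (trans (sym eq) (sym (++-identityʳ (σ x)))))))
                  (sym (map-++ σ* P [ [ x ] ])))
    ; isParse = subst Parse (sym (concat-∷ʳ gs _)) (parse-++-chars p′ rhs)
    ; cost    = inj₂ (subst (Copyable _) concat-map-[ rhs ]
                        (range (concat gs) (map [_] rhs) []
                          (trans (concat-∷ʳ gs _) (cong (concat gs ++_) (sym (++-identityʳ _))))) ,
                      len)
    }
    where
    len : length (concat (gs ∷ʳ map [_] rhs)) ≤ length (P ∷ʳ [ x ]) + length rhs
    len rewrite concat-∷ʳ gs (map [_] rhs) | length-++ (concat gs) {map [_] rhs} | length-map [_] rhs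
              | length-∷ʳ P [ x ] = m≤n⇒m≤1+n (+-monoˡ-≤ (length rhs) le)
  parse-subst (copy p (range xs ys zs refl)) with parse-subst p
  ... | S with map-++⁻ concat (groups S) (map σ* xs) (trans (images S) (map-++ σ* xs _))
  ... | gx , gyz , eq , _ , eqyz with map-++⁻ concat gyz (map σ* ys) (trans eqyz (map-++ σ* ys zs))
  ... | gy , gz , refl , eqy , _ =
    extend (concat ys) S [ concat (concat gy) ] image
      (copy (isParse S) (range (concat gx) (concat gy) (concat gz) ranges)) ≤-refl
    where
    open ≡-Reasoning
    ranges : concat (groups S) ≡ concat gx ++ concat gy ++ concat gz
    ranges = trans (cong concat eq) (trans (sym (concat-++ gx (gy ++ gz)))
               (cong (concat gx ++_) (sym (concat-++ gy gz))))
    image : concat (concat gy) ++ [] ≡ σ* (concat ys)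
    image = begin
      concat (concat gy) ++ []  ≡⟨ ++-identityʳ _ ⟩
      concat (concat gy)        ≡⟨ concat-concat gy ⟨
      concat (map concat gy)    ≡⟨ cong concat eqy ⟩
      concat (map σ* ys)        ≡⟨ concat-σ* ys ⟩
      σ* (concat ys)            ∎

  parse-concatMap : Parse P → ∃[ P′ ] Parse P′ × concat P′ ≡ σ* (concat P) × length P′ ≤ length P + length rhs
  parse-concatMap {P = P} p with parse-subst p
  ... | substituted gs eqs p′ c = concat gs , p′ , word , len c
    where
    word : concat (concat gs) ≡ σ* (concat P)
    word = trans (sym (concat-concat gs)) (trans (cong concat eqs) (concat-σ* P))
    len : Cost P (concat gs) → length (concat gs) ≤ length P + length rhs
    len (inj₁ le)       = ≤-trans le (m≤m+n _ _)
    len (inj₂ (_ , le)) = le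

-- Each element of `xs` is matched with an occurrence in `ys`, which is then removed; uniqueness
-- keeps the remaining elements inside what is left. It bounds the total length of selected rules by
-- the grammar size and, for a constant `f`, gives the pigeonhole principle.
sum-map-⊆ : ∀ {A : Set} (f : A → ℕ) {xs ys} → Unique xs → xs ⊆ ys → sum (map f xs) ≤ sum (map f ys)
sum-map-⊆ f {[]}     _            _   = z≤n
sum-map-⊆ f {x ∷ xs} u@(_ ∷ uxs) sub with ∈-∃++ (sub (here refl))
... | as , bs , refl = begin
  f x + sum (map f xs)                        ≤⟨ +-monoʳ-≤ (f x) (sum-map-⊆ f uxs sub′) ⟩
  f x + sum (map f (as ++ bs))                ≡⟨ cong (f x +_) (sum-map-++ as bs) ⟩
  f x + (sum (map f as) + sum (map f bs))     ≡⟨ +-assoc (f x) _ _ ⟨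
  f x + sum (map f as) + sum (map f bs)       ≡⟨ cong (_+ sum (map f bs)) (+-comm (f x) _) ⟩
  sum (map f as) + f x + sum (map f bs)       ≡⟨ +-assoc (sum (map f as)) (f x) _ ⟩
  sum (map f as) + (f x + sum (map f bs))     ≡⟨ sum-map-++ as (x ∷ bs) ⟨
  sum (map f (as ++ [ x ] ++ bs))             ∎
  where
  open ≤-Reasoning
  sum-map-++ : ∀ as bs → sum (map f (as ++ bs)) ≡ sum (map f as) + sum (map f bs)
  sum-map-++ as bs = trans (cong sum (map-++ f as bs)) (sum-++ (map f as) (map f bs))
  sub′ : xs ⊆ as ++ bs
  sub′ {y} y∈xs with ∈-++⁻ as (sub (there y∈xs))
  ... | inj₁ y∈as            = ∈-++⁺ˡ y∈as
  ... | inj₂ (here refl)     = contradiction y∈xs (Unique.Unique[x∷xs]⇒x∉xs u)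
  ... | inj₂ (there y∈bs)    = ∈-++⁺ʳ as y∈bs

-- Extracting and expanding a straight-line grammar

Rules : ℕ → Set
Rules N = List (Fin N × List (Symbol N))

module _ {N : ℕ} where

  heads : Rules N → List (Fin N)
  heads = map proj₁

  totalLength : Rules N → ℕ
  totalLength R = sum (map (λ r → length (proj₂ r)) R)

  Resolved : Rules N → Symbol N → Set
  Resolved R (inj₁ X) = X ∈ heads R
  Resolved R (inj₂ _) = ⊤

  -- A topologically sorted acyclic grammar: right-hand sides refer only to rules further down the
  -- list. A grammar of a single string may still contain cycles and competing rules, so such a list
  -- has to be extracted from it.
  data Straight : Rules N → Set where
    []   : Straight []
    rule : ∀ {X rhs R} → X ∉ heads R → All (Resolved R) rhs → Straight R → Straight ((X , rhs) ∷ R)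

  straight-unique : ∀ {R} → Straight R → Unique R
  straight-unique []                 = []
  straight-unique (rule X∉R _ strR) =
    All.tabulate (λ r∈R eq → X∉R (subst (_∈ _) (cong proj₁ (sym eq)) (∈-map⁺ proj₁ r∈R))) ∷ straight-unique strR

  resolved-mono : ∀ {R R′} → heads R ⊆ heads R′ → ∀ {X} → Resolved R X → Resolved R′ X
  resolved-mono sub {inj₁ X} X∈ = sub X∈
  resolved-mono sub {inj₂ a} _  = tt

  -- References point only down the list, so the rules above that of `X` can be discarded, which
  -- brings the rule of `X` to the front.
  straight-from : ∀ {R X} → Straight R → X ∈ heads R →
                  ∃[ rhs ] ∃[ R′ ] Straight ((X , rhs) ∷ R′) × ((X , rhs) ∷ R′) ⊆ R
  straight-from s@(rule _ _ _)  (here refl)  = _ , _ , s , λ r∈ → r∈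
  straight-from (rule _ _ strR) (there X∈R) =
    let rhs , R′ , s , sub = straight-from strR X∈R in rhs , R′ , s , there ∘ sub

  expand : Fin N → List (Symbol N) → Symbol N → List (Symbol N)
  expand X rhs (inj₁ Y) with Y Fin.≟ X
  ... | yes _ = rhs
  ... | no  _ = [ inj₁ Y ]
  expand X rhs (inj₂ a) = [ inj₂ a ]

  expand-cases : ∀ X rhs Y → expand X rhs Y ≡ [ Y ] ⊎ expand X rhs Y ≡ rhs
  expand-cases X rhs (inj₁ Y) with Y Fin.≟ X
  ... | yes _ = inj₂ refl
  ... | no  _ = inj₁ refl
  expand-cases X rhs (inj₂ a) = inj₁ refl

  expand-resolved : ∀ {X rhs R} → All (Resolved R) rhs → ∀ s → All (Resolved ((X , rhs) ∷ R)) s →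
                    All (Resolved R) (concatMap (expand X rhs) s)
  expand-resolved ok []           []         = []
  expand-resolved {X} ok (inj₁ Y ∷ s) (r ∷ rs) with Y Fin.≟ X
  expand-resolved ok (inj₁ Y ∷ s) (r ∷ rs)          | yes _   = All.++⁺ ok (expand-resolved ok s rs)
  expand-resolved ok (inj₁ Y ∷ s) (here refl ∷ rs)  | no Y≢X = contradiction refl Y≢X
  expand-resolved ok (inj₁ Y ∷ s) (there Y∈R ∷ rs)  | no _   = Y∈R ∷ expand-resolved ok s rs
  expand-resolved ok (inj₂ a ∷ s) (_ ∷ rs) = tt ∷ expand-resolved ok s rs

  module _ (G : CFG N) where

    record Resolution (R : Rules N) (Goal : Rules N → Set) : Set where
      constructor resolution
      field
        {table}  : Rules N
        straight : Straight table
        subset   : table ⊆ rules G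
        extends  : heads R ⊆ heads table
        goal     : Goal table

    -- A post-order walk through a derivation tree: the children are resolved first, so the rule of
    -- a node can go on top of the table. If its nonterminal already has a rule, that one is kept,
    -- even when the derivation uses a different rule here.
    resolveSym : ∀ {R X w} → DerivesSym G X w → Straight R → R ⊆ rules G → Resolution R (λ T → Resolved T X)
    resolveSeq : ∀ {R Xs w} → DerivesSeq G Xs w → Straight R → R ⊆ rules G → Resolution R (λ T → All (Resolved T) Xs)

    resolveSym (term a) s sub = resolution s sub (λ x → x) tt
    resolveSym (rule {A = X} X∈ ds) s sub with resolveSeq ds s sub
    ... | resolution {T} s′ sub′ ext ok with _∈?_ Fin._≟_ X (heads T)
    ... | yes X∈T = resolution s′ sub′ ext X∈T
    ... | no  X∉T = resolution (rule X∉T ok s′) (λ { (here refl) → X∈ ; (there r∈) → sub′ r∈ })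
                      (there ∘ ext) (here refl)

    resolveSeq []       s sub = resolution s sub (λ x → x) []
    resolveSeq (d ∷ ds) s sub with resolveSym d s sub
    ... | resolution s₁ sub₁ ext₁ ok₁ with resolveSeq ds s₁ sub₁
    ... | resolution s₂ sub₂ ext₂ ok₂ =
      resolution s₂ sub₂ (ext₂ ∘ ext₁) (resolved-mono ext₂ ok₁ ∷ ok₂)

    derivesSeq-++⁻ : ∀ Xs {Ys w} → DerivesSeq G (Xs ++ Ys) w →
                     ∃[ u ] ∃[ v ] w ≡ u ++ v × DerivesSeq G Xs u × DerivesSeq G Ys v
    derivesSeq-++⁻ []       ds = [] , _ , refl , [] , ds
    derivesSeq-++⁻ (X ∷ Xs) (_∷_ {u = x} d ds) with derivesSeq-++⁻ Xs ds
    ... | u , v , refl , du , dv = x ++ u , v , sym (++-assoc x u v) , d ∷ du , dv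

    unexpand : ∀ {X rhs} → (X , rhs) ∈ rules G → ∀ s {w} →
               DerivesSeq G (concatMap (expand X rhs) s) w → DerivesSeq G s w
    unexpand r∈ [] ds = ds
    unexpand {X} r∈ (inj₁ Y ∷ s) ds with Y Fin.≟ X
    unexpand {X} {rhs} r∈ (inj₁ Y ∷ s) ds | yes refl with derivesSeq-++⁻ rhs ds
    ... | u , v , refl , du , dv = rule r∈ du ∷ unexpand r∈ s dv
    unexpand r∈ (inj₁ Y ∷ s) (d ∷ ds) | no _ = d ∷ unexpand r∈ s ds
    unexpand r∈ (inj₂ a ∷ s) (d ∷ ds) = d ∷ unexpand r∈ s ds

    derives-terminals : ∀ s → All (Resolved []) s → DerivesSeq G s (mapMaybe isInj₂ s)
    derives-terminals []           []       = []
    derives-terminals (inj₂ a ∷ s) (_ ∷ rs) = term a ∷ derives-terminals s rs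

    -- Each rule is applied to all occurrences of its nonterminal at once and adds at most the
    -- length of its right-hand side. Later rules cannot reintroduce that nonterminal.
    expandAll : ∀ {R P} → Straight R → R ⊆ rules G → Parse P → All (Resolved R) (concat P) →
                ∃[ P′ ] Parse P′ × DerivesSeq G (concat P) (concat P′) × length P′ ≤ length P + totalLength R
    expandAll {P = P} [] sub p ok =
      -- Only terminals are left, so this projection merely strips the constructor `inj₂`.
      project isInj₂ P , parse-project isInj₂ p ,
      subst (DerivesSeq G (concat P)) (sym (concat-project isInj₂ P)) (derives-terminals (concat P) ok) ,
      ≤-trans (length-project isInj₂ P) (m≤m+n _ _)
    expandAll {P = P} (rule {X} {rhs} {R} _ okrhs s) sub p ok
      with parse-concatMap (expand X rhs) rhs (expand-cases X rhs) p
    ... | P₁ , p₁ , eq₁ , len₁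
      with expandAll s (sub ∘ there) p₁ (subst (All (Resolved R)) (sym eq₁) (expand-resolved okrhs (concat P) ok))
    ... | P₂ , p₂ , d₂ , len₂ =
      P₂ , p₂ , unexpand (sub (here refl)) (concat P) (subst (λ s → DerivesSeq G s (concat P₂)) eq₁ d₂) ,
      ≤-trans len₂ (≤-trans (+-monoˡ-≤ (totalLength R) len₁) (≤-reflexive (+-assoc (length P) (length rhs) _)))

    -- The table may choose rules other than those in the given derivation of `S`. The expanded word
    -- is still generated by `G`, and is `S` because `G` generates nothing else.
    parse-of-grammar : ∀ {S} → GeneratesExactly G S →
                       ∃[ P ] Parse P × concat P ≡ S × length P ≤ size G
    parse-of-grammar (only , d) with resolveSym d [] (λ ())
    ... | resolution s sub _ start∈ with straight-from s start∈
    ... | rhs , R , s′@(rule _ ok sR) , sub′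
      with expandAll sR (sub ∘ sub′ ∘ there) (parse-++-chars [] rhs)
             (subst (All (Resolved R)) (sym concat-map-[ rhs ]) ok)
    ... | P , p , dP , len =
      P , p ,
      only _ (rule (sub (sub′ (here refl))) (subst (λ s → DerivesSeq G s (concat P)) concat-map-[ rhs ] dP)) ,
      ≤-trans len (subst (λ l → l + totalLength R ≤ size G) (sym (length-map [_] rhs))
        (sum-map-⊆ (λ r → length (proj₂ r)) (straight-unique s′) (sub ∘ sub′)))

    needsPhrases⇒≤size : ∀ {K S} → NeedsPhrases K S → GeneratesExactly G S → K ≤ size G
    needsPhrases⇒≤size lb gen = let P , p , eq , len = parse-of-grammar gen in ≤-trans (lb p eq) len

-- Incompressible binary words

length-⊆ : {xs ys : List A} → Unique xs → xs ⊆ ys → length xs ≤ length ys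
length-⊆ {xs = xs} {ys} u sub =
  subst₂ _≤_ (sum-ones xs) (sum-ones ys) (sum-map-⊆ (λ _ → 1) u sub)
  where
  sum-ones : ∀ (xs : List A) → sum (map (λ _ → 1) xs) ≡ length xs
  sum-ones []       = refl
  sum-ones (x ∷ xs) = cong suc (sum-ones xs)

fresh : DecidableEquality A → {xs : List A} (ys : List A) → Unique xs → length ys < length xs →
        ∃[ x ] x ∈ xs × x ∉ ys
fresh _≟_ {xs} ys u lt = find (All.¬All⇒Any¬ (λ x → _∈?_ _≟_ x ys) xs
  λ all → <⇒≱ lt (length-⊆ u (All.lookup all)))

length-cartesianProductWith : ∀ (f : A → B → C) xs ys →
                              length (cartesianProductWith f xs ys) ≡ length xs * length ys
length-cartesianProductWith f []       ys = refl
length-cartesianProductWith f (x ∷ xs) ys =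
  trans (length-++ (map (f x) ys))
        (cong₂ _+_ (length-map (f x) ys) (length-cartesianProductWith f xs ys))

gapThen : ℕ → List Bool → List Bool
gapThen g v = replicate g false ++ true ∷ v

gapThen-injective : ∀ g h {v w} → gapThen g v ≡ gapThen h w → g ≡ h × v ≡ w
gapThen-injective zero    zero    refl = refl , refl
gapThen-injective zero    (suc h) ()
gapThen-injective (suc g) zero    ()
gapThen-injective (suc g) (suc h) eq with gapThen-injective g h (proj₂ (∷-injective eq))
... | refl , eq′ = refl , eq′

length-gapThen : ∀ g v → length (gapThen g v) ≡ g + suc (length v)
length-gapThen g v = trans (length-++ (replicate g false)) (cong (_+ suc (length v)) (length-replicate g))

-- The gaps grow geometrically: this bounds d_k by 2k, and the j-th gap still
-- has 2·4^j possible values, so there are 2^(L²) words of length below 4^L.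
sparse : ℕ → List (List Bool)
sparse zero    = [ [] ]
sparse (suc j) = cartesianProductWith (λ c → gapThen (4 ^ j + c)) (upTo (2 * 4 ^ j)) (sparse j)

sparse-unique : ∀ L → Unique (sparse L)
sparse-unique zero    = [] ∷ []
sparse-unique (suc j) = Unique.cartesianProductWith⁺ _ inj (Unique.upTo⁺ (2 * 4 ^ j)) (sparse-unique j)
  where
  inj : ∀ {w x y z} → gapThen (4 ^ j + w) y ≡ gapThen (4 ^ j + x) z → w ≡ x × y ≡ z
  inj {w} {x} eq = let eq₁ , eq₂ = gapThen-injective (4 ^ j + w) (4 ^ j + x) eq
                   in +-cancelˡ-≡ (4 ^ j) w x eq₁ , eq₂

length-sparse : ∀ L → length (sparse L) ≡ 2 ^ (L * L)
length-sparse zero    = refl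
length-sparse (suc j) = begin
  length (sparse (suc j))                        ≡⟨ length-cartesianProductWith _ (upTo (2 * 4 ^ j)) (sparse j) ⟩
  length (upTo (2 * 4 ^ j)) * length (sparse j)  ≡⟨ cong₂ _*_ (length-upTo (2 * 4 ^ j)) (length-sparse j) ⟩
  2 * 4 ^ j * 2 ^ (j * j)                        ≡⟨ cong (λ x → 2 * x * 2 ^ (j * j)) (^-*-assoc 2 2 j) ⟩
  2 ^ (1 + 2 * j) * 2 ^ (j * j)                  ≡⟨ ^-distribˡ-+-* 2 (1 + 2 * j) (j * j) ⟨
  2 ^ (1 + 2 * j + j * j)                        ≡⟨ cong (2 ^_) (square j) ⟩
  2 ^ (suc j * suc j)                            ∎
  where
  open ≡-Reasoning
  square : ∀ j → 1 + 2 * j + j * j ≡ suc j * suc j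
  square = solve-∀

-- Placed in front of a parse, these two phrases turn literal phrases into copies as well, so every
-- phrase is described by a pair of numbers.
letters : List (List Bool)
letters = [ false ] ∷ [ true ] ∷ []

appendRange : List (List A) → ℕ × ℕ → List (List A)
appendRange Q (i , l) = Q ∷ʳ concat (take l (drop i Q))

-- All results of `K` copying steps with start and length below `b`. Pairs that overrun the list are
-- harmless, as `take` and `drop` truncate.
reachable : ℕ → ℕ → List (List (List Bool))
reachable b zero    = [ letters ]
reachable b (suc K) = cartesianProductWith appendRange (reachable b K) (cartesianProduct (upTo b) (upTo b))

length-reachable : ∀ b K → length (reachable b K) ≡ (b * b) ^ K
length-reachable b zero    = refl
length-reachable b (suc K) = begin
  length (reachable b (suc K))  ≡⟨ length-cartesianProductWith appendRange (reachable b K) _ ⟩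
  length (reachable b K) * length (cartesianProduct (upTo b) (upTo b))
                                ≡⟨ cong₂ _*_ (length-reachable b K) (length-cartesianProductWith _,_ (upTo b) (upTo b)) ⟩
  (b * b) ^ K * (length (upTo b) * length (upTo b))
                                ≡⟨ cong (λ x → (b * b) ^ K * (x * x)) (length-upTo b) ⟩
  (b * b) ^ K * (b * b)         ≡⟨ *-comm ((b * b) ^ K) (b * b) ⟩
  (b * b) ^ suc K               ∎
  where open ≡-Reasoning

take-drop-++ : ∀ (xs ys zs : List A) → take (length ys) (drop (length xs) (xs ++ ys ++ zs)) ≡ ys
take-drop-++ []       []       zs = refl
take-drop-++ []       (y ∷ ys) zs = cong (y ∷_) (take-drop-++ [] ys zs)
take-drop-++ (x ∷ xs) ys       zs = take-drop-++ xs ys zs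

reachable-step : ∀ b K {Q i l} → Q ∈ reachable b K → i < b → l < b →
                 appendRange Q (i , l) ∈ reachable b (suc K)
reachable-step b K Q∈ i< l< =
  ∈-cartesianProductWith⁺ appendRange Q∈ (∈-cartesianProduct⁺ (∈-upTo⁺ i<) (∈-upTo⁺ l<))

parse-reachable : ∀ {b P} → Parse P → 2 + length P ≤ b → letters ++ P ∈ reachable b (length P)
parse-reachable [] _ = here refl
parse-reachable {b} (char {Q = Q} p x) le rewrite length-∷ʳ Q [ x ] = step x
  where
  ih : letters ++ Q ∈ reachable b (length Q)
  ih = parse-reachable p (≤-trans (n≤1+n _) le)
  step : ∀ x → letters ++ Q ∷ʳ [ x ] ∈ reachable b (suc (length Q))
  -- The literals are the ranges `(0 , 1)` and `(1 , 1)`, which lie in `letters`.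
  step false = reachable-step b (length Q) ih (≤-trans z<s le) (≤-trans (s≤s z<s) le)
  step true  = reachable-step b (length Q) ih (≤-trans (s≤s z<s) le) (≤-trans (s≤s z<s) le)
parse-reachable {b} (copy {Q = Q} p (range xs ys zs refl)) le rewrite length-∷ʳ Q (concat ys) =
  subst (λ w → letters ++ Q ∷ʳ concat w ∈ reachable b (suc (length Q))) (take-drop-++ xs ys zs)
    -- The offset 2 skips the phrases of `letters`.
    (reachable-step b (length Q) {i = 2 + length xs} {l = length ys} (parse-reachable p (≤-trans (n≤1+n _) le))
      (≤-trans (s≤s (s≤s (s≤s xs≤))) le)
      (≤-trans (s≤s (≤-trans ys≤ (m≤n⇒m≤1+n (n≤1+n _)))) le))
  where
  lengths : length (xs ++ ys ++ zs) ≡ length xs + (length ys + length zs)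
  lengths = trans (length-++ xs) (cong (length xs +_) (length-++ ys))
  xs≤ : length xs ≤ length (xs ++ ys ++ zs)
  xs≤ = subst (length xs ≤_) (sym lengths) (m≤m+n _ _)
  ys≤ : length ys ≤ length (xs ++ ys ++ zs)
  ys≤ = subst (length ys ≤_) (sym lengths) (≤-trans (m≤m+n _ _) (m≤n+m _ (length xs)))

-- Copying the empty range `(0 , 0)` adds a step without changing the word, so parses with fewer
-- phrases are counted along with those of exactly `n`.
reachable-pad : ∀ {b K n Q} → 0 < b → Q ∈ reachable b K → K ≤′ n →
                ∃[ Q′ ] Q′ ∈ reachable b n × concat Q′ ≡ concat Q
reachable-pad 0<b Q∈ ≤′-refl         = _ , Q∈ , refl
reachable-pad {b} 0<b Q∈ (≤′-step {n} K≤′n) with reachable-pad 0<b Q∈ K≤′n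
... | Q′ , Q′∈ , eq = Q′ ∷ʳ [] , reachable-step b n Q′∈ 0<b 0<b ,
                      trans (concat-∷ʳ Q′ []) (trans (++-identityʳ (concat Q′)) eq)

afterFirst : List Bool → List Bool
afterFirst []          = []
afterFirst (false ∷ s) = afterFirst s
afterFirst (true ∷ s)  = s

afterFirst-gapThen : ∀ g v → afterFirst (gapThen g v) ≡ v
afterFirst-gapThen zero    v = refl
afterFirst-gapThen (suc g) v = afterFirst-gapThen g v

-- Drops the two letters contributed by `letters`, then the leading gap and its true. Since `v` is
-- recovered whatever the gap, the count of describable words does not depend on `g`.
decode : List (List Bool) → List Bool
decode Q = afterFirst (drop 2 (concat Q))

describable : ℕ → List (List Bool)
describable zero    = []
describable (suc K) = map decode (reachable (4 + K) (suc K))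

parse-describable : ∀ K {P g v} → Parse P → length P ≤ K → concat P ≡ gapThen g v → v ∈ describable K
parse-describable zero {[]}    {zero}  p le ()
parse-describable zero {[]}    {suc g} p le ()
parse-describable (suc K) {P} {g} {v} p le eq
  with reachable-pad z<s (parse-reachable {4 + K} p (s≤s (s≤s (m≤n⇒m≤1+n le)))) (≤⇒≤′ le)
... | Q , Q∈ , eqQ =
  subst (_∈ describable (suc K))
    (trans (cong (afterFirst ∘ drop 2) eqQ) (trans (cong afterFirst eq) (afterFirst-gapThen g v)))
    (∈-map⁺ decode Q∈)

describable-few : ∀ L K → (0 < K → ((3 + K) * (3 + K)) ^ K < 2 ^ (L * L)) →
                  length (describable K) < length (sparse L)
describable-few L zero    few = subst (0 <_) (sym (length-sparse L)) (m^n>0 2 (L * L))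
describable-few L (suc K) few = begin-strict
  length (describable (suc K))           ≡⟨ length-map decode (reachable (4 + K) (suc K)) ⟩
  length (reachable (4 + K) (suc K))     ≡⟨ length-reachable (4 + K) (suc K) ⟩
  ((4 + K) * (4 + K)) ^ suc K            <⟨ few z<s ⟩
  2 ^ (L * L)                            ≡⟨ length-sparse L ⟨
  length (sparse L)                      ∎
  where open ≤-Reasoning

-- By counting, some `v` is not describable. It is chosen before `g`, so the same `v` can be used
-- behind leading gaps of any length.
exists-incompressible : ∀ L K → (0 < K → ((3 + K) * (3 + K)) ^ K < 2 ^ (L * L)) →
  ∃[ v ] v ∈ sparse L × (∀ g → NeedsPhrases (suc K) (gapThen g v))
exists-incompressible L K few
  with fresh (≡-dec Bool._≟_) (describable K) (sparse-unique L) (describable-few L K few)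
... | v , v∈ , v∉ = v , v∈ , λ g {P} p eq → ≰⇒> λ le → v∉ (parse-describable K {g = g} p le eq)

-- Distinct substrings

-- The recursion follows the suffixes, so covers can be built letter by letter. `W` may contain
-- further words: only an upper bound on the number of substrings is wanted.
data Covers {A : Set} (k : ℕ) (W : List (List A)) : List A → Set where
  []  : Covers k W []
  _∷_ : ∀ {x s} → (k ≤ length (x ∷ s) → take k (x ∷ s) ∈ W) → Covers k W s → Covers k W (x ∷ s)

covers-lookup : 0 < k → Covers k W s → ∀ i → i + k ≤ length s → take k (drop i s) ∈ W
covers-lookup 0<k []      i       le = contradiction (≤-trans (m≤n+m _ i) le) (<⇒≱ 0<k)
covers-lookup 0<k (c ∷ _) zero    le = c le
covers-lookup 0<k (_ ∷ c) (suc i) le = covers-lookup 0<k c i (≤-pred le)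

covers-⊆ : W ⊆ W′ → Covers k W s → Covers k W′ s
covers-⊆ sub []       = []
covers-⊆ sub (c ∷ cs) = (sub ∘ c) ∷ covers-⊆ sub cs

covers-map : ∀ (f : A → B) → Covers k W s → Covers k (map (map f) W) (map f s)
covers-map f []       = []
covers-map {k = k} f (_∷_ {x} {s} c cs) =
  (λ le → subst (_∈ _) (sym (take-map k (x ∷ s)))
     (∈-map⁺ (map f) (c (subst (k ≤_) (length-map f (x ∷ s)) le)))) ∷ covers-map f cs

d≤length : ∀ {k W S} → 0 < k → k ≤ length S → Covers k W S → d k S ≤ length W
d≤length {k} {W} {S} 0<k k≤ c =
  length-⊆ (deduplicate-! (≡-dec _≟_) (substringsOfLength k S)) (inW ∘ ∈-deduplicate⁻ (≡-dec _≟_) _)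
  where
  inW : ∀ {w} → w ∈ substringsOfLength k S → w ∈ W
  inW w∈ with ∈-map⁻ _ w∈
  ... | i , i∈ , refl = covers-lookup 0<k c i
          (≤-trans (+-monoˡ-≤ k (≤-pred (∈-upTo⁻ i∈))) (≤-reflexive (m∸n+n≡m k≤)))

letters≤d₁ : ∀ {m S} → (∀ {x} → x < m → x ∈ S) → m ≤ d 1 S
letters≤d₁ {m} {S} letter∈ = subst (_≤ d 1 S) (trans (length-map [_] (upTo m)) (length-upTo m))
  (length-⊆ (Unique.map⁺ (proj₁ ∘ ∷-injective) (Unique.upTo⁺ m)) (∈-deduplicate⁺ (≡-dec _≟_) ∘ isSubstring))
  where
  position : ∀ {x} {s : Str} → x ∈ s → ∃[ i ] i < suc (length s ∸ 1) × take 1 (drop i s) ≡ [ x ]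
  position (here refl) = 0 , z<s , refl
  position {s = _ ∷ y ∷ s} (there x∈) with position x∈
  ... | i , i< , eq = suc i , s≤s i< , eq
  isSubstring : ∀ {w} → w ∈ map [_] (upTo m) → w ∈ substringsOfLength 1 S
  isSubstring w∈ with ∈-map⁻ [_] w∈
  ... | x , x∈ , refl with position (letter∈ (∈-upTo⁻ x∈))
  ... | i , i< , eq = subst (_∈ substringsOfLength 1 S) eq (∈-map⁺ _ (∈-upTo⁺ i<))

Coverable : ℕ → ℕ → List A → Set
Coverable k m s = ∃[ W ] length W ≤ m × Covers k W s

coverable-map : ∀ {m} (f : A → B) → Coverable k m s → Coverable k m (map f s)
coverable-map f (W , le , c) =
  map (map f) W , ≤-trans (≤-reflexive (length-map (map f) W)) le , covers-map f c

coverable-∷ : ∀ {m x} → Coverable k m s → Coverable k (suc m) (x ∷ s)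
coverable-∷ {k = k} {s = s} {x = x} (W , le , c) =
  take k (x ∷ s) ∷ W , s≤s le , ((λ _ → here refl) ∷ covers-⊆ there c)

coverable-prepend : ∀ {m} (u : List A) → Coverable k m s → Coverable k (length u + m) (u ++ s)
coverable-prepend []      c = c
coverable-prepend (x ∷ u) c = coverable-∷ (coverable-prepend u c)

take-++-long : ∀ k (u t : List A) → k ≤ length u → take k (u ++ t) ≡ take k u
take-++-long zero    u       t le       = refl
take-++-long (suc k) (x ∷ u) t (s≤s le) = cong (x ∷_) (take-++-long k u t le)

-- `C` collects the windows that start in `s` and leave it. The bound by `length s` carries the
-- induction: a window is added only when `x ∷ s` has at most `k` letters, and this yields the bound
-- by `k`.
crossing : ∀ {W W′ : List (List A)} (s : List A) → Covers (suc k) W s → Covers (suc k) W′ s′ →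
           ∃[ C ] length C ≤ length s × length C ≤ k × Covers (suc k) (C ++ W ++ W′) (s ++ s′)
crossing {W = W} [] [] c′ = [] , z≤n , z≤n , covers-⊆ (∈-++⁺ʳ W) c′
crossing {k = k} {s′ = s′} {W = W} {W′} (x ∷ s) (c ∷ cs) c′ with crossing s cs c′ | suc k ≤? length (x ∷ s)
... | C , ≤s , ≤k , covers | yes long = C , m≤n⇒m≤1+n ≤s , ≤k ,
  ((λ _ → subst (_∈ C ++ W ++ W′) (sym (take-++-long (suc k) (x ∷ s) s′ long)) (∈-++⁺ʳ C (∈-++⁺ˡ (c long)))) ∷ covers)
... | C , ≤s , ≤k , covers | no short = take (suc k) (x ∷ s ++ s′) ∷ C , s≤s ≤s , ≤-trans (s≤s ≤s) (≤-pred (≰⇒> short)) ,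
  ((λ _ → here refl) ∷ covers-⊆ there covers)

coverable-++ : ∀ {m m′} → Coverable (suc k) m s → Coverable (suc k) m′ s′ →
               Coverable (suc k) (k + (m + m′)) (s ++ s′)
coverable-++ {s = s} (W , le , c) (W′ , le′ , c′) with crossing s c c′
... | C , _ , ≤k , covers = C ++ W ++ W′ ,
  ≤-trans (≤-reflexive (trans (length-++ C) (cong (length C +_) (length-++ W)))) (+-mono-≤ ≤k (+-mono-≤ le le′)) ,
  covers

windows : ∀ k (s : List A) → Coverable (suc k) (length s ∸ k) s
windows k []      = [] , z≤n , []
windows k (x ∷ s) with windows k s | k ≤? length s
... | W , le , c | yes k≤ = take (suc k) (x ∷ s) ∷ W ,
  subst (suc (length W) ≤_) (sym (+-∸-assoc 1 k≤)) (s≤s le) , ((λ _ → here refl) ∷ covers-⊆ there c)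
... | W , le , c | no k≰  = W , ≤-trans le (∸-monoˡ-≤ k (n≤1+n _)) ,
  ((λ k< → contradiction (≤-pred k<) k≰) ∷ c)

-- Substring counts of words with growing gaps

data Gapped : List Bool → Set where
  []   : Gapped []
  gap  : ∀ {g v} → length v < g → Gapped v → Gapped (gapThen g v)

-- The two conclusions need each other: the next gap is at least `4 ^ j`, so the length bound on the
-- rest is what makes it dominate.
sparse-gapped : ∀ L {v} → v ∈ sparse L → Gapped v × length v < 4 ^ L
sparse-gapped zero    (here refl) = [] , z<s
sparse-gapped (suc j) v∈ with ∈-cartesianProductWith⁻ (λ c → gapThen (4 ^ j + c)) (upTo (2 * 4 ^ j)) (sparse j) v∈
... | c , v , c∈ , v∈′ , refl with sparse-gapped j v∈′
... | gv , lv = gap (≤-trans lv (m≤m+n (4 ^ j) c)) gv , (begin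
  suc (length (gapThen (4 ^ j + c) v)) ≡⟨ cong suc (length-gapThen (4 ^ j + c) v) ⟩
  suc (4 ^ j + c + suc (length v))     ≡⟨ regroup (4 ^ j) c (length v) ⟩
  4 ^ j + (suc c + suc (length v))     ≤⟨ +-monoʳ-≤ (4 ^ j) (+-mono-≤ (∈-upTo⁻ c∈) lv) ⟩
  4 ^ j + (2 * 4 ^ j + 4 ^ j)          ≡⟨ four (4 ^ j) ⟩
  4 ^ suc j                            ∎)
  where
  open ≤-Reasoning
  regroup : ∀ a c l → suc (a + c + suc l) ≡ a + (suc c + suc l)
  regroup = solve-∀
  four : ∀ a → a + (2 * a + a) ≡ 4 * a
  four = solve-∀

take-gap : ∀ {k g} r → k ≤ g → take k (replicate g false ++ r) ≡ replicate k false
take-gap {zero}          r le       = refl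
take-gap {suc k} {suc g} r (s≤s le) = cong (false ∷_) (take-gap r le)

take-gapThen : ∀ {k} i {g h} r r′ → k ≤ i + suc g → k ≤ i + suc h →
               take k (gapThen i (replicate g false ++ r)) ≡ take k (gapThen i (replicate h false ++ r′))
take-gapThen {zero}  i       r r′ le       le′       = refl
take-gapThen {suc k} zero    r r′ (s≤s le) (s≤s le′) = cong (true ∷_) (trans (take-gap r le) (sym (take-gap r′ le′)))
take-gapThen {suc k} (suc i) r r′ (s≤s le) (s≤s le′) = cong (false ∷_) (take-gapThen i r r′ le le′)

-- Index `i` is the position of the true; `i = k` pushes it out of the window and gives the
-- all-false word. The trailing `++ []` fits the form of `take-gapThen`.
atMostOneTrue : ℕ → List (List Bool)
atMostOneTrue k = map (λ i → take k (gapThen i (replicate k false ++ []))) (upTo (suc k))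

∈-atMostOneTrue : ∀ {k} i {g} r → k ≤ i + suc g → take k (gapThen i (replicate g false ++ r)) ∈ atMostOneTrue k
∈-atMostOneTrue {k} i {g} r le with i ≤? k
... | yes i≤k = subst (_∈ atMostOneTrue k)
  (take-gapThen i [] r (≤-trans (n≤1+n k) (m≤n+m (suc k) i)) le) (∈-map⁺ _ (∈-upTo⁺ (s≤s i≤k)))
... | no  i≰k = subst (_∈ atMostOneTrue k)
  (trans (take-gap (true ∷ replicate k false ++ []) ≤-refl) (sym (take-gap _ (<⇒≤ (≰⇒> i≰k)))))
  (∈-map⁺ _ (∈-upTo⁺ ≤-refl))

covers-gapThen : ∀ {k W v} → (∀ p → k ≤ length (gapThen p v) → take k (gapThen p v) ∈ W) → Covers k W v →
                 ∀ p → Covers k W (gapThen p v)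
covers-gapThen f c zero    = f 0 ∷ c
covers-gapThen f c (suc p) = f (suc p) ∷ covers-gapThen f c p

covers-dropGap : ∀ {k W v} p → Covers k W (gapThen p v) → Covers k W v
covers-dropGap zero    (_ ∷ c) = c
covers-dropGap (suc p) (_ ∷ c) = covers-dropGap p c

covers-gapThen⁻ : ∀ {k W v} o p → Covers k W (gapThen (o + p) v) → k ≤ length (gapThen p v) → take k (gapThen p v) ∈ W
covers-gapThen⁻ zero    zero    (c ∷ _) = c
covers-gapThen⁻ zero    (suc p) (c ∷ _) = c
covers-gapThen⁻ (suc o) p       (_ ∷ c) = covers-gapThen⁻ o p c

-- If g is the largest gap visible in a window (g + 2 ≤ k) then windows with two
-- trues start in a stretch no longer than the word after that gap, which is < g.
gapped-covers : ∀ k {v} → Gapped v → ∃[ W ] length W ≤ k ×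
                (∀ p → Covers (suc k) (atMostOneTrue (suc k) ++ W) (gapThen p v))
gapped-covers k [] = [] , z≤n , covers-gapThen
  (λ p le → ∈-++⁺ˡ (∈-atMostOneTrue p {0} [] (≤-trans le (≤-reflexive (length-gapThen p []))))) []
gapped-covers k (gap {g} {v} lt gv) with suc k ≤? suc g
... | yes k≤ = let W , le , c = gapped-covers k gv in
  W , le , covers-gapThen (λ p _ → ∈-++⁺ˡ (∈-atMostOneTrue p {g} (true ∷ v) (≤-trans k≤ (m≤n+m (suc g) p)))) (c g)
... | no  k≰ with m≤n⇒∃[o]m+o≡n (≰⇒> k≰)
-- Windows have length `2 + g + m`. One that starts `p` letters before the true preceding this gap
-- reaches the next true exactly when `p ≤ m`, so those with two trues lie inside
-- `gapThen m (gapThen g v)`.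
... | m , refl with windows (suc g + m) (gapThen m (gapThen g v))
... | W , le , c = W , bound , covers-gapThen inW (covers-⊆ (∈-++⁺ʳ _) (covers-dropGap m c))
  where
  open ≤-Reasoning
  regroup : ∀ m g l → m + suc (g + suc l) ≡ suc g + m + suc l
  regroup = solve-∀
  bound : length W ≤ suc g + m
  bound = begin
    length W                                                   ≤⟨ le ⟩
    length (gapThen m (gapThen g v)) ∸ (suc g + m)             ≡⟨ cong (_∸ (suc g + m)) (trans (length-gapThen m _)
                                                                    (cong (λ l → m + suc l) (length-gapThen g v))) ⟩
    m + suc (g + suc (length v)) ∸ (suc g + m)                 ≡⟨ cong (_∸ (suc g + m)) (regroup m g (length v)) ⟩
    suc g + m + suc (length v) ∸ (suc g + m)                   ≡⟨ m+n∸m≡n (suc g + m) _ ⟩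
    suc (length v)                                             ≤⟨ lt ⟩
    g                                                          ≤⟨ ≤-trans (n≤1+n g) (m≤m+n (suc g) m) ⟩
    suc g + m                                                  ∎
  inW : ∀ p → suc (suc g + m) ≤ length (gapThen p (gapThen g v)) →
        take (suc (suc g + m)) (gapThen p (gapThen g v)) ∈ atMostOneTrue (suc (suc g + m)) ++ W
  inW p len with suc (suc g + m) ≤? p + suc g
  ... | yes k≤ = ∈-++⁺ˡ (∈-atMostOneTrue p {g} (true ∷ v) k≤)
  ... | no  k≰ with m≤n⇒∃[o]m+o≡n {p} {m} (+-cancelˡ-≤ (suc g) p m
                      (≤-trans (≤-reflexive (+-comm (suc g) p)) (≤-pred (≰⇒> k≰))))
  ... | o , refl = ∈-++⁺ʳ (atMostOneTrue (suc (suc g + (p + o))))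
                     (covers-gapThen⁻ {2 + g + (p + o)} {v = gapThen g v} o p
                       (subst (λ m → Covers (2 + g + (p + o)) W (gapThen m (gapThen g v))) (+-comm p o) c)
                       len)

gapped-coverable : ∀ k {v} p → Gapped v → Coverable (suc k) (2 * suc k) (gapThen p v)
gapped-coverable k p gv with gapped-covers k gv
... | W , le , c = atMostOneTrue (suc k) ++ W , (begin
  length (atMostOneTrue (suc k) ++ W)         ≡⟨ length-++ (atMostOneTrue (suc k)) ⟩
  length (atMostOneTrue (suc k)) + length W   ≡⟨ cong (_+ length W) (trans (length-map _ (upTo (2 + k))) (length-upTo (2 + k))) ⟩
  2 + k + length W                            ≤⟨ +-monoʳ-≤ (2 + k) le ⟩
  2 + k + k                                   ≡⟨ double k ⟩
  2 * suc k                                   ∎) , c p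
  where
  open ≤-Reasoning
  double : ∀ k → 2 + k + k ≡ 2 * suc k
  double = solve-∀

-- The string S

letter : ℕ → Bool → ℕ
letter i false = i * 2
letter i true  = suc (i * 2)

unletter : ℕ → ℕ → Maybe Bool
unletter i x with x ≟ i * 2 | x ≟ suc (i * 2)
... | yes _ | _     = just false
... | no  _ | yes _ = just true
... | no  _ | no  _ = nothing

unletter-letter : ∀ i b → unletter i (letter i b) ≡ just b
unletter-letter i false with i * 2 ≟ i * 2
... | yes _ = refl
... | no ≢  = contradiction refl ≢
unletter-letter i true with suc (i * 2) ≟ i * 2 | suc (i * 2) ≟ suc (i * 2)
... | yes eq | _     = contradiction eq 1+n≢n
... | no  _  | yes _ = refl
... | no  _  | no ≢  = contradiction refl ≢

letter-≥ : ∀ i b → i * 2 ≤ letter i b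
letter-≥ i false = ≤-refl
letter-≥ i true  = n≤1+n _

letter-< : ∀ i b → letter i b < suc i * 2
letter-< i false = s≤s (n≤1+n _)
letter-< i true  = ≤-refl

module _ (v : List Bool) (pad : ℕ) where

  -- The padding to length `n` lengthens the leading gap of the last block, on which neither the
  -- phrase bound nor the window bound depends. Leading gaps are positive, so both letters of each
  -- alphabet occur.
  blocks : ℕ → Str
  blocks zero    = map (letter 0) (gapThen (suc pad) v)
  blocks (suc i) = map (letter (suc i)) (gapThen 1 v) ++ blocks i

  -- The `r` single letters raise the number of distinct letters to `suc t * 2 + r`, the intended
  -- value of δ.
  word : ℕ → ℕ → Str
  word t r = applyUpTo (suc t * 2 +_) r ++ blocks t

  blocks-< : ∀ i → All (_< suc i * 2) (blocks i)
  blocks-< zero    = All.map⁺ (All.universal (letter-< 0) (gapThen (suc pad) v))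
  blocks-< (suc i) = All.++⁺ (All.map⁺ (All.universal (letter-< (suc i)) (gapThen 1 v)))
                             (All.map (λ x< → ≤-trans x< (m≤n+m (suc i * 2) 2)) (blocks-< i))

  private
    below : ℕ → ℕ → Bool
    below m x = does (x <? m)

    below-true : ∀ {m s} → All (_< m) s → Uniform (below m) true s
    below-true = All.map (dec-true (_ <? _))

    below-false : ∀ {m s} → All (m ≤_) s → Uniform (below m) false s
    below-false = All.map (dec-false (_ <? _) ∘ ≤⇒≯)

  module _ {K : ℕ} (needs : ∀ g → NeedsPhrases K (gapThen g v)) where

    -- Alphabets decrease along the word, so the threshold `suc i * 2` is false on the first block
    -- and true on all later ones.
    blocks-needs : ∀ i → NeedsPhrases (suc i * K) (blocks i)
    blocks-needs zero    = subst (λ K → NeedsPhrases K (blocks 0)) (sym (+-identityʳ K))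
      (needsPhrases-map (letter 0) (unletter 0) (unletter-letter 0) (needs (suc pad)))
    blocks-needs (suc i) = needsPhrases-++ (below (suc i * 2))
      (below-false (All.map⁺ (All.universal (letter-≥ (suc i)) (gapThen 1 v))))
      (below-true (blocks-< i))
      (needsPhrases-map (letter (suc i)) (unletter (suc i)) (unletter-letter (suc i)) (needs 1))
      (blocks-needs i)

    word-needs : ∀ t r → NeedsPhrases (suc t * K) (word t r)
    word-needs t r = needsPhrases-++ (below (suc t * 2)) {K = 0}
      (below-false (All.applyUpTo⁺₂ _ r (λ j → m≤m+n (suc t * 2) j)))
      (below-true (blocks-< t))
      (λ _ _ → z≤n)
      (blocks-needs t)

  length-blocks : ∀ i → length (blocks i) ≡ pad + suc i * (2 + length v)
  length-blocks zero    = trans (length-map (letter 0) (gapThen (suc pad) v))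
    (trans (length-gapThen (suc pad) v) (arith pad (length v)))
    where
    arith : ∀ p l → suc p + suc l ≡ p + 1 * (2 + l)
    arith = solve-∀
  length-blocks (suc i) = trans (cong (λ l → 2 + l)
    (trans (length-++ (map (letter (suc i)) v)) (cong₂ _+_ (length-map (letter (suc i)) v) (length-blocks i))))
    (arith pad (length v) i)
    where
    arith : ∀ p l i → 2 + (l + (p + suc i * (2 + l))) ≡ p + suc (suc i) * (2 + l)
    arith = solve-∀

  length-word : ∀ t r → length (word t r) ≡ pad + (r + suc t * (2 + length v))
  length-word t r = trans (length-++ (applyUpTo (suc t * 2 +_) r))
    (trans (cong₂ _+_ (length-applyUpTo (suc t * 2 +_) r) (length-blocks t)) (swap r pad _))
    where
    swap : ∀ a b c → a + (b + c) ≡ b + (a + c)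
    swap = solve-∀

  blocks-letters : ∀ i {x} → x < suc i * 2 → x ∈ blocks i
  blocks-letters zero {0} _ = here refl
  blocks-letters zero {1} _ = there (∈-map⁺ (letter 0) (∈-++⁺ʳ (replicate pad false) (here refl)))
  blocks-letters zero {suc (suc _)} (s≤s (s≤s ()))
  blocks-letters (suc i) {x} x< with x ≟ suc i * 2 | x ≟ suc (suc i * 2)
  ... | yes refl | _        = here refl
  ... | no _     | yes refl = there (here refl)
  ... | no ≢₁    | no ≢₂    = there (there (∈-++⁺ʳ (map (letter (suc i)) v) (blocks-letters i
    (≤∧≢⇒< (≤-pred (≤∧≢⇒< (≤-pred x<) ≢₂)) ≢₁))))

  word-letters : ∀ t r {x} → x < suc t * 2 + r → x ∈ word t r
  word-letters t r {x} x< with x <? suc t * 2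
  ... | yes x<2t = ∈-++⁺ʳ (applyUpTo (suc t * 2 +_) r) (blocks-letters t x<2t)
  ... | no  x≮2t with m≤n⇒∃[o]m+o≡n (≮⇒≥ x≮2t)
  ... | j , refl = ∈-++⁺ˡ (∈-applyUpTo⁺ (suc t * 2 +_) (+-cancelˡ-< (suc t * 2) j r x<))

  module _ (gv : Gapped v) where

    blocks-coverable : ∀ k i → Coverable (suc k) (2 * suc k + i * (k + 2 * suc k)) (blocks i)
    blocks-coverable k zero    = subst (λ m → Coverable (suc k) m (blocks 0)) (sym (+-identityʳ _))
      (coverable-map (letter 0) (gapped-coverable k (suc pad) gv))
    blocks-coverable k (suc i) = subst (λ m → Coverable (suc k) m (blocks (suc i))) (regroup k (2 * suc k) _)
      (coverable-++ (coverable-map (letter (suc i)) (gapped-coverable k 1 gv)) (blocks-coverable k i))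
      where
      regroup : ∀ k a b → k + (a + (a + b)) ≡ a + (k + a + b)
      regroup = solve-∀

    -- For windows of length `k` the `t + 1` blocks give `2k` each, the `t` boundaries `k - 1` each
    -- and the single letters `r`. Since `t ≤ r`, boundaries and single letters together give at
    -- most `r * k`.
    word-d : ∀ t r → t ≤ r → ∀ k → 1 ≤ k → k ≤ length (word t r) → d k (word t r) ≤ (suc t * 2 + r) * k
    word-d t r t≤r (suc k) 1≤k k≤
      with coverable-prepend (applyUpTo (suc t * 2 +_) r) (blocks-coverable k t)
    ... | W , le , c = begin
      d (suc k) (word t r)                                ≤⟨ d≤length 1≤k k≤ c ⟩
      length W                                            ≤⟨ le ⟩
      length (applyUpTo (suc t * 2 +_) r) + (2 * suc k + t * (k + 2 * suc k))
                                                          ≡⟨ cong (_+ (2 * suc k + t * (k + 2 * suc k))) (length-applyUpTo (suc t * 2 +_) r) ⟩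
      r + (2 * suc k + t * (k + 2 * suc k))               ≡⟨ regroup₁ t r k ⟩
      r + (2 + 2 * t) * suc k + t * k                     ≤⟨ +-monoʳ-≤ (r + (2 + 2 * t) * suc k) (*-monoˡ-≤ k t≤r) ⟩
      r + (2 + 2 * t) * suc k + r * k                     ≡⟨ regroup₂ t r k ⟩
      (suc t * 2 + r) * suc k                             ∎
      where
      open ≤-Reasoning
      regroup₁ : ∀ t r k → r + (2 * suc k + t * (k + 2 * suc k)) ≡ r + (2 + 2 * t) * suc k + t * k
      regroup₁ = solve-∀
      regroup₂ : ∀ t r k → r + (2 + 2 * t) * suc k + r * k ≡ (suc t * 2 + r) * suc k
      regroup₂ = solve-∀

    word-hasDelta : ∀ t r → t ≤ r → HasDelta (word t r) (suc t * 2 + r)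
    word-hasDelta t r t≤r = word-d t r t≤r , 1 , ≤-refl , nonempty ,
      ≤-antisym (word-d t r t≤r 1 ≤-refl nonempty)
                (≤-trans (≤-reflexive (*-identityʳ (suc t * 2 + r))) (letters≤d₁ {S = word t r} (word-letters t r)))
      where
      nonempty : 1 ≤ length (word t r)
      nonempty = ∈-length (word-letters t r {0} z<s)

-- Logarithms and the arithmetic of the bound

n<2^[1+⌊log₂n⌋] : ∀ n → n < 2 ^ suc ⌊log₂ n ⌋
n<2^[1+⌊log₂n⌋] n = ≰⇒> λ le →
  1+n≰n (subst (_≤ ⌊log₂ n ⌋) (⌊log₂[2^n]⌋≡n (suc ⌊log₂ n ⌋)) (⌊log₂⌋-mono-≤ le))

2^k≤n : ∀ k {n} → 0 < n → k ≤ ⌊log₂ n ⌋ → 2 ^ k ≤ n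
2^k≤n zero    0<n _ = 0<n
2^k≤n (suc k) {suc (suc n)} _ le = begin
  2 * 2 ^ k       ≤⟨ *-monoʳ-≤ 2 (2^k≤n k z<s (≤-trans (≤-pred′ le) (≤-reflexive (sym (⌊log₂⌊n/2⌋⌋≡⌊log₂n⌋∸1 m))))) ⟩
  2 * h           ≡⟨ cong (h +_) (+-identityʳ h) ⟩
  h + h           ≤⟨ +-monoʳ-≤ h (⌊n/2⌋≤⌈n/2⌉ m) ⟩
  h + ⌈ m /2⌉     ≡⟨ ⌊n/2⌋+⌈n/2⌉≡n m ⟩
  m               ∎
  where
  open ≤-Reasoning
  m = suc (suc n)
  h = ⌊ m /2⌋
  ≤-pred′ : ∀ {a b} → suc a ≤ b → a ≤ b ∸ 1
  ≤-pred′ (s≤s le) = le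

module _ (ℓ : ℕ) where

  private
    -- With `ℓ` the logarithm of n/δ, halving gives `4 ^ L ≤ 2 ^ ℓ`, which is at most n/δ; `e` is
    -- the denominator of the final bound.
    L = ℓ / 2
    e = suc ⌊log₂ ℓ ⌋

  -- A phrase is two numbers below `3 + K` of at most `2e` bits each, so `K` phrases take `4eK`
  -- bits. The constant 8 makes this strictly less than `L * L` when `K` is positive.
  phraseBound : ℕ
  phraseBound = L * L / (8 * e)

  private
    K = phraseBound

    2L≤ℓ : 2 * L ≤ ℓ
    2L≤ℓ = ≤-trans (≤-reflexive (*-comm 2 L)) (m/n*n≤m ℓ 2)

    ℓ≤2L+1 : ℓ ≤ 2 * L + 1
    ℓ≤2L+1 = begin
      ℓ                ≡⟨ m≡m%n+[m/n]*n ℓ 2 ⟩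
      ℓ % 2 + L * 2    ≤⟨ +-monoˡ-≤ (L * 2) (≤-pred (m%n<n ℓ 2)) ⟩
      1 + L * 2        ≡⟨ swap L ⟩
      2 * L + 1        ∎
      where
      open ≤-Reasoning
      swap : ∀ a → 1 + a * 2 ≡ 2 * a + 1
      swap = solve-∀

  4^[ℓ/2]≤2^ℓ : 4 ^ (ℓ / 2) ≤ 2 ^ ℓ
  4^[ℓ/2]≤2^ℓ = ≤-trans (≤-reflexive (^-*-assoc 2 2 L)) (^-monoʳ-≤ 2 2L≤ℓ)

  few-descriptions : 0 < K → ((3 + K) * (3 + K)) ^ K < 2 ^ (L * L)
  few-descriptions 0<K = begin-strict
    ((3 + K) * (3 + K)) ^ K         ≤⟨ ^-monoˡ-≤ K (*-mono-≤ 3+K≤ 3+K≤) ⟩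
    (2 ^ (e + e) * 2 ^ (e + e)) ^ K ≡⟨ cong (_^ K) (^-distribˡ-+-* 2 (e + e) (e + e)) ⟨
    (2 ^ (e + e + (e + e))) ^ K     ≡⟨ ^-*-assoc 2 (e + e + (e + e)) K ⟩
    2 ^ ((e + e + (e + e)) * K)     <⟨ ^-monoʳ-< 2 (s≤s (s≤s z≤n)) exponent ⟩
    2 ^ (L * L)                     ∎
    where
    open ≤-Reasoning
    3+K≤ : 3 + K ≤ 2 ^ (e + e)
    3+K≤ = begin
      3 + K              ≤⟨ +-monoˡ-≤ K (*-monoʳ-≤ 3 0<K) ⟩
      3 * K + K          ≡⟨ four K ⟩
      4 * K              ≤⟨ *-monoʳ-≤ 4 (m/n≤m (L * L) (8 * e)) ⟩
      4 * (L * L)        ≡⟨ square L ⟩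
      2 * L * (2 * L)    ≤⟨ *-mono-≤ 2L≤ℓ 2L≤ℓ ⟩
      ℓ * ℓ              ≤⟨ *-mono-≤ (<⇒≤ (n<2^[1+⌊log₂n⌋] ℓ)) (<⇒≤ (n<2^[1+⌊log₂n⌋] ℓ)) ⟩
      2 ^ e * 2 ^ e      ≡⟨ ^-distribˡ-+-* 2 e e ⟨
      2 ^ (e + e)        ∎
      where
      four : ∀ a → 3 * a + a ≡ 4 * a
      four = solve-∀
      square : ∀ a → 4 * (a * a) ≡ 2 * a * (2 * a)
      square = solve-∀
    exponent : (e + e + (e + e)) * K < L * L
    exponent = begin-strict
      (e + e + (e + e)) * K  ≡⟨ regroup₁ e K ⟩
      4 * (e * K)            <⟨ *-monoˡ-< (e * K) {{>-nonZero (*-mono-≤ {1} {e} {1} {K} (s≤s z≤n) 0<K)}}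
                               {4} {8} (s≤s (s≤s (s≤s (s≤s (s≤s z≤n))))) ⟩
      8 * (e * K)            ≡⟨ regroup₂ e K ⟩
      K * (8 * e)            ≤⟨ m/n*n≤m (L * L) (8 * e) ⟩
      L * L                  ∎
      where
      regroup₁ : ∀ a b → (a + a + (a + a)) * b ≡ 4 * (a * b)
      regroup₁ = solve-∀
      regroup₂ : ∀ a b → 8 * (a * b) ≡ b * (8 * a)
      regroup₂ = solve-∀

  -- From `ℓ ≤ 2L + 1` comes a bound of `8L² + 1`. As `L²` is at most `8e(1 + K)`, the first term
  -- costs 64 and the summand 1 another 8.
  ℓ²≤72e[1+K] : ℓ ^ 2 ≤ 72 * (e * suc K)
  ℓ²≤72e[1+K] = begin
    ℓ ^ 2                                 ≡⟨ cong (ℓ *_) (*-identityʳ ℓ) ⟩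
    ℓ * ℓ                                 ≤⟨ *-mono-≤ ℓ≤2L+1 ℓ≤2L+1 ⟩
    (2 * L + 1) * (2 * L + 1)             ≡⟨ expanded L ⟩
    4 * (L * L) + 4 * L + 1               ≤⟨ +-monoˡ-≤ 1 (+-monoʳ-≤ (4 * (L * L)) (*-monoʳ-≤ 4 (n≤n² L))) ⟩
    4 * (L * L) + 4 * (L * L) + 1         ≤⟨ +-mono-≤ (+-mono-≤ (*-monoʳ-≤ 4 L²≤) (*-monoʳ-≤ 4 L²≤))
                                               (*-mono-≤ {1} {8} (s≤s z≤n) (*-mono-≤ {1} {e} {1} {suc K} (s≤s z≤n) (s≤s z≤n))) ⟩
    4 * (8 * (e * suc K)) + 4 * (8 * (e * suc K)) + 8 * (e * suc K)
                                          ≡⟨ collect (e * suc K) ⟩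
    72 * (e * suc K)                      ∎
    where
    open ≤-Reasoning
    n≤n² : ∀ n → n ≤ n * n
    n≤n² zero    = z≤n
    n≤n² (suc n) = m≤m*n (suc n) (suc n)
    expanded : ∀ a → (2 * a + 1) * (2 * a + 1) ≡ 4 * (a * a) + 4 * a + 1
    expanded = solve-∀
    collect : ∀ a → 4 * (8 * a) + 4 * (8 * a) + 8 * a ≡ 72 * a
    collect = solve-∀
    regroup : ∀ a k → 8 * a + k * (8 * a) ≡ 8 * (a * suc k)
    regroup = solve-∀
    L²≤ : L * L ≤ 8 * (e * suc K)
    L²≤ = begin
      L * L                               ≡⟨ m≡m%n+[m/n]*n (L * L) (8 * e) ⟩
      L * L % (8 * e) + K * (8 * e)       ≤⟨ +-monoˡ-≤ (K * (8 * e)) (<⇒≤ (m%n<n (L * L) (8 * e))) ⟩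
      8 * e + K * (8 * e)                 ≡⟨ regroup e K ⟩
      8 * (e * suc K)                     ∎

-- Choice of parameters

HardString : ℕ → ℕ → Set
HardString n δ = Σ Str (λ S → length S ≡ n × HasDelta S δ ×
  (∀ {N} (G : CFG N) → GeneratesExactly G S → boundNum n δ ≤ 288 * (size G * boundDen n δ)))

-- `t ≤ r` lets the single letters pay for the boundaries, and `r ≤ suc t * 2` makes δ at most four
-- times the number of blocks, whence 288 = 4 · 72.
hardString : ∀ t r n → t ≤ r → r ≤ suc t * 2 → suc t * 2 + r ≤ n → HardString n (suc t * 2 + r)
hardString t r n t≤r r≤2t δ≤n = word v pad t r , len , word-hasDelta v pad gapped t r t≤r , bound
  where
  open ≤-Reasoning
  δ q ℓ L K : ℕ
  δ = suc t * 2 + r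
  q = n ÷ δ
  ℓ = ⌊log₂ q ⌋
  L = ℓ / 2
  K = phraseBound ℓ

  incompressible : ∃[ v ] v ∈ sparse L × (∀ g → NeedsPhrases (suc K) (gapThen g v))
  incompressible = exists-incompressible L K (few-descriptions ℓ)
  v = proj₁ incompressible
  gapped = proj₁ (sparse-gapped L (proj₁ (proj₂ incompressible)))

  0<q : 0 < q
  0<q = m≥n⇒m/n>0 δ≤n

  v<q : length v < q
  v<q = begin-strict
    length v   <⟨ proj₂ (sparse-gapped L (proj₁ (proj₂ incompressible))) ⟩
    4 ^ L      ≤⟨ 4^[ℓ/2]≤2^ℓ ℓ ⟩
    2 ^ ℓ      ≤⟨ 2^k≤n ℓ 0<q ≤-refl ⟩
    q          ∎

  unpadded≤n : r + suc t * (2 + length v) ≤ n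
  unpadded≤n = begin
    -- `q` is positive and exceeds `length v`, so a block of `2 + length v` letters fits into `2q`
    -- and a single letter into `q`.
    r + suc t * (2 + length v)   ≤⟨ +-mono-≤ (m≤m*n r q {{>-nonZero 0<q}}) (*-monoʳ-≤ (suc t) (+-mono-≤ 0<q v<q)) ⟩
    r * q + suc t * (q + q)      ≡⟨ regroup r t q ⟩
    q * (suc t * 2 + r)          ≤⟨ m/n*n≤m n δ ⟩
    n                            ∎
    where
    regroup : ∀ r t q → r * q + suc t * (q + q) ≡ q * (suc t * 2 + r)
    regroup = solve-∀

  pad = n ∸ (r + suc t * (2 + length v))

  len : length (word v pad t r) ≡ n
  len = trans (length-word v pad t r) (m∸n+n≡m unpadded≤n)

  bound : ∀ {N} (G : CFG N) → GeneratesExactly G (word v pad t r) → boundNum n δ ≤ 288 * (size G * boundDen n δ)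
  bound G gen = begin
    δ * ℓ ^ 2                                     ≤⟨ *-mono-≤ (+-monoʳ-≤ (suc t * 2) r≤2t) (ℓ²≤72e[1+K] ℓ) ⟩
    (suc t * 2 + suc t * 2) * (72 * (suc ⌊log₂ ℓ ⌋ * suc K))
                                                  ≡⟨ regroup (suc t) (suc ⌊log₂ ℓ ⌋) (suc K) ⟩
    288 * (suc t * suc K * suc ⌊log₂ ℓ ⌋)         ≤⟨ *-monoʳ-≤ 288 (*-monoˡ-≤ (suc ⌊log₂ ℓ ⌋)
                                                       (needsPhrases⇒≤size G (word-needs v pad (proj₂ (proj₂ incompressible)) t r) gen)) ⟩
    288 * (size G * suc ⌊log₂ ℓ ⌋)                ∎
    where
    regroup : ∀ a b c → (a * 2 + a * 2) * (72 * (b * c)) ≡ 288 * (a * c * b)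
    regroup = solve-∀

theorem3 : Σ ℕ (λ c → 1 ≤ c × ((n δ : ℕ) → 2 ≤ δ → δ ≤ n →
    Σ Str (λ S → length S ≡ n × HasDelta S δ ×
    (∀ {N} (G : CFG N) → GeneratesExactly G S →
    boundNum n δ ≤ c * (size G * boundDen n δ)))))
theorem3 = 288 , s≤s z≤n , hard
  where
  hard : ∀ n δ → 2 ≤ δ → δ ≤ n → HardString n δ
  hard n (suc (suc δ)) (s≤s (s≤s z≤n)) δ≤n =
    subst (HardString n) (sym split) (hardString t r n (m≤m+n t _) r≤ (subst (_≤ n) split δ≤n))
    where
    -- Here `δ` is the original value minus 2, the letters of the first block. Each further block
    -- takes three: two for its alphabet and one single letter for its boundary. The remainder also
    -- goes to single letters.
    t = δ / 3
    r = t + δ % 3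
    regroup : ∀ ρ t → 2 + (ρ + t * 3) ≡ suc t * 2 + (t + ρ)
    regroup = solve-∀
    split : 2 + δ ≡ suc t * 2 + r
    split = trans (cong (2 +_) (m≡m%n+[m/n]*n δ 3)) (regroup (δ % 3) t)
    r≤ : r ≤ suc t * 2
    r≤ = ≤-trans (≤-reflexive (+-comm t (δ % 3)))
           (+-mono-≤ (≤-pred (m%n<n δ 3)) (m≤m*n t 2))
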